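{- Let $M$ be a loopless matroid of rank $n$ on a finite set $E$, let $R\subseteq E$ and $Q=E\setminus R$. Suppose that there are positive integers $r,q\ge 1$ such that $|\overline{x}\cap R|\, r=|\overline{x}\cap Q|\, q$ for all $x\in E$. Then $\widetilde{N}_k^2=\widetilde{N}_{k-1}\widetilde{N}_{k+1}$ for all $k\in\{1,\dots,n-1\}$. In particular, $\widetilde{N}_k=\frac{q}{r}\widetilde{N}_{k-1}$ for all $k\in\{1,\dots,n\}$.
   Context: For $0\le k\le n$, $N_k$ is the number of bases of $M$ with exactly $k$ elements in $R$, and $\widetilde{N}_k=N_k/\binom{n}{k}$. For $x\in E$, $\overline{x}$ denotes the closure of $\{x\}$ in $M$ (since $M$ is loopless, this is the parallel class of $x$). -}

module Defs where

open import Data.Fin.Base using (Fin)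
open import Data.Fin.Subset
open import Data.Fin.Subset.Properties using (_⊆?_; _⊂?_; anySubset?)
open import Data.Integer.Base using (+_)
open import Data.List.Base using (List; []; _∷_; _++_; map; filter; length)
open import Data.List.Extrema.Nat using (max)
open import Data.Nat.Base
  using (ℕ; zero; suc; _∸_; _≤_; _<_; NonZero; _!; >-nonZero)
open import Data.Nat.Combinatorics using (_C_; nCk≡n!/k![n-k]!; k![n∸k]!∣n!)
open import Data.Nat.Divisibility using (∣⇒≤)
open import Data.Nat.DivMod using (m≥n⇒m/n>0)
open import Data.Nat.Properties using (_≟_; _!≢0; _!*_!≢0)
open import Data.Product.Base using (∃; _×_)
open import Data.Rational.Base using (ℚ; _/_)
import Data.Vec.Base as Vec
open import Relation.Binary.PropositionalEquality.Core using (_≡_; sym; subst)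
open import Relation.Nullary using (¬_; does; ¬?; _×-dec_)
open import Relation.Unary using (Decidable)

-- A matroid on the ground set Fin m, given by its independent sets.
-- Independence is decidable, so that rank and the number of bases are
-- actual natural numbers; classically this is no restriction.
record Matroid (m : ℕ) : Set₁ where
  field
    Indep      : Subset m → Set
    indep?     : Decidable Indep
    ⊥-indep    : Indep ⊥
    hereditary : ∀ {I J} → I ⊆ J → Indep J → Indep I
    augment    : ∀ {I J} → Indep I → Indep J → ∣ I ∣ < ∣ J ∣ →
                 ∃ λ x → x ∈ J × x ∉ I × Indep (I ∪ ⁅ x ⁆)

subsets : ∀ m → List (Subset m)
subsets zero    = Vec.[] ∷ []
subsets (suc m) =
  map (outside Vec.∷_) (subsets m) ++ map (inside Vec.∷_) (subsets m)

nCk≢0 : ∀ n k → k ≤ n → NonZero (n C k)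
nCk≢0 n k k≤n = >-nonZero (subst (0 <_) (sym (nCk≡n!/k![n-k]! k≤n))
  (m≥n⇒m/n>0 (∣⇒≤ (k![n∸k]!∣n! k≤n))))
  where instance
    _ = n !≢0
    _ = k !* (n ∸ k) !≢0

module _ {m : ℕ} (M : Matroid m) where
  open Matroid M

  Base : Subset m → Set
  Base B = Indep B × ¬ (∃ λ I → Indep I × B ⊂ I)

  base? : Decidable Base
  base? B = indep? B ×-dec ¬? (anySubset? λ I → indep? I ×-dec B ⊂? I)

  rank : Subset m → ℕ
  rank S = max 0 (map ∣_∣ (filter (λ I → indep? I ×-dec I ⊆? S) (subsets m)))

  rk : ℕ
  rk = rank ⊤

  closure : Subset m → Subset m
  closure S = Vec.tabulate λ y → does (rank (S ∪ ⁅ y ⁆) ≟ rank S)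

  Loop : Fin m → Set
  Loop x = ¬ Indep ⁅ x ⁆

  Loopless : Set
  Loopless = ∀ x → ¬ Loop x

  N : Subset m → ℕ → ℕ
  N R k = length (filter (λ B → base? B ×-dec (∣ B ∩ R ∣ ≟ k)) (subsets m))

  Ñ : Subset m → (k : ℕ) → .(k ≤ rk) → ℚ
  Ñ R k k≤n = _/_ (+ N R k) (rk C k) {{nCk≢0 rk k k≤n}}

{-# OPTIONS --safe #-}
-- Count the pairs (I , x) with x ∉ I and I ∪ {x} a base, |I ∩ R| = k, by whether x lies
-- in R or in Q. Grouping by the base I ∪ {x} gives (k+1) N_{k+1} for x ∈ R and (n-k) N_k
-- for x ∈ Q. Grouping by I, the admissible x form a union of parallel classes, so that
-- r times the first count is q times the second. Together with
-- (k+1) C(n,k+1) = (n-k) C(n,k) this is the geometric recurrence, which implies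
-- equality in the log-concavity inequality.
module Submission where

open import Defs
import Algebra.Properties.Semiring.Sum as SemiringSum
open import Data.Bool.Base using (Bool; true; false; not; _∧_; if_then_else_)
open import Data.Bool.Properties using (∧-conicalˡ; ∧-conicalʳ)
open import Data.Fin.Base using (Fin; zero; suc)
import Data.Fin.Properties as Fin
open import Data.Fin.Subset
open import Data.Fin.Subset.Properties
open import Data.Integer.Base using (+_) renaming (_*_ to _*ℤ_)
import Data.Integer.Properties as ℤ
open import Data.List.Base using (List; []; _∷_; _++_; map; filter; length)
open import Data.List.Extrema.Nat using (xs≤max; argmax-sel)
open import Data.List.Membership.Propositional using () renaming (_∈_ to _∈ˡ_)
open import Data.List.Membership.Propositional.Properties
  using (∈-map⁺; ∈-map⁻; ∈-++⁺ˡ; ∈-++⁺ʳ; ∈-filter⁺; ∈-filter⁻)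
import Data.List.Properties as List
import Data.List.Relation.Unary.All as All
open import Data.List.Relation.Unary.Any using (here)
open import Data.Nat.Base
  using (ℕ; zero; suc; pred; _≤_; _<_; _∸_; s≤s; NonZero) renaming (_+_ to _+ℕ_; _*_ to _*ℕ_)
open import Data.Nat.Combinatorics using (_C_; nCk+nC[k+1]≡[n+1]C[k+1]; nC1≡n)
open import Data.Nat.Induction using (<-wellFounded)
open import Data.Nat.ListAction using (sum)
open import Data.Nat.ListAction.Properties using (sum-++)
open import Data.Nat.Properties as ℕ hiding (_≟_)
open import Data.Nat.Solver using (module +-*-Solver)
open import Data.Product.Base using (_×_; _,_; ∃; proj₁; proj₂)
open import Data.Rational.Base using (_/_; _*_; toℚᵘ)
import Data.Rational.Properties as ℚ
import Data.Rational.Unnormalised.Base as ℚᵘ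
import Data.Rational.Unnormalised.Properties as ℚᵘ
open import Data.Sum.Base using (inj₁; inj₂)
open import Data.Vec.Base using ([]; _∷_; lookup; tabulate)
open import Data.Vec.Properties using (lookup-zipWith; lookup∘tabulate; lookup⇒[]=; []=⇒lookup)
open import Function.Base using (_∘_; id; case_of_)
open import Induction.WellFounded using (Acc; acc)
open import Level using (0ℓ)
open import Relation.Binary.PropositionalEquality
open import Relation.Nullary using (¬_; Dec; yes; no; does; _×-dec_; contradiction)
open import Relation.Nullary.Decidable using (dec-true; decidable-stable)
open import Relation.Unary using (Pred; Decidable)

private
  module Fin∑ = SemiringSum +-*-semiring

private variable
  A : Set
  m : ℕ

-- Indicators and finite sums of natural numbers.

𝟙 : Bool → ℕ
𝟙 b = if b then 1 else 0

𝟙-∧ : ∀ a b → 𝟙 (a ∧ b) ≡ 𝟙 a *ℕ 𝟙 b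
𝟙-∧ true  b = sym (+-identityʳ (𝟙 b))
𝟙-∧ false b = refl

-- Where `A` or `B` fails both sides vanish, so `d` has to agree with `c` only where both hold. This
-- lets a constant factor be traded for a cardinality inside a weighted sum.
*-𝟙-cong : ∀ {B : Set} {c d} (a? : Dec A) (b? : Dec B) → (A → B → d ≡ c) →
           c *ℕ (𝟙 (does a?) *ℕ 𝟙 (does b?)) ≡ (𝟙 (does a?) *ℕ 𝟙 (does b?)) *ℕ d
*-𝟙-cong {c = c} (no _)  _       _   = *-zeroʳ c
*-𝟙-cong {c = c} (yes _) (no _)  _   = *-zeroʳ c
*-𝟙-cong {c = c} (yes a) (yes b) d≡c rewrite d≡c a b = *-comm c 1

∑ : List A → (A → ℕ) → ℕ
∑ xs f = sum (map f xs)

∑-cong : (xs : List A) {f g : A → ℕ} → (∀ x → f x ≡ g x) → ∑ xs f ≡ ∑ xs g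
∑-cong xs f≗g = cong sum (List.map-cong f≗g xs)

∑-++ : ∀ (xs ys : List A) (f : A → ℕ) → ∑ (xs ++ ys) f ≡ ∑ xs f +ℕ ∑ ys f
∑-++ xs ys f = trans (cong sum (List.map-++ f xs ys)) (sum-++ (map f xs) (map f ys))

∑-map : ∀ {B : Set} (h : A → B) xs (f : B → ℕ) → ∑ (map h xs) f ≡ ∑ xs (f ∘ h)
∑-map h xs f = cong sum (sym (List.map-∘ xs))

∑-zero : (xs : List A) → ∑ xs (λ _ → 0) ≡ 0
∑-zero []       = refl
∑-zero (x ∷ xs) = ∑-zero xs

*-distribˡ-∑ : ∀ c (xs : List A) f → c *ℕ ∑ xs f ≡ ∑ xs (λ x → c *ℕ f x)
*-distribˡ-∑ c []       f = *-zeroʳ c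
*-distribˡ-∑ c (x ∷ xs) f =
  trans (*-distribˡ-+ c (f x) _) (cong (c *ℕ f x +ℕ_) (*-distribˡ-∑ c xs f))

∑-Fin∑-comm : ∀ (xs : List A) (f : A → Fin m → ℕ) →
              ∑ xs (λ x → Fin∑.sum (f x)) ≡ Fin∑.sum (λ i → ∑ xs (λ x → f x i))
∑-Fin∑-comm {m = m} []       f = sym (Fin∑.sum-replicate-zero m)
∑-Fin∑-comm         (x ∷ xs) f =
  trans (cong (Fin∑.sum (f x) +ℕ_) (∑-Fin∑-comm xs f))
        (sym (Fin∑.∑-distrib-+ (f x) (λ i → ∑ xs (λ y → f y i))))

length-filter-∑ : ∀ {P : Pred A 0ℓ} (P? : Decidable P) xs →
                  length (filter P? xs) ≡ ∑ xs (𝟙 ∘ does ∘ P?)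
length-filter-∑ P? []       = refl
length-filter-∑ P? (x ∷ xs) with does (P? x)
... | true  = cong suc (length-filter-∑ P? xs)
... | false = length-filter-∑ P? xs

-- Cardinalities of finite subsets.

∣∣-sum : (p : Subset m) → ∣ p ∣ ≡ Fin∑.sum (λ i → 𝟙 (lookup p i))
∣∣-sum []            = refl
∣∣-sum (outside ∷ p) = ∣∣-sum p
∣∣-sum (inside ∷ p)  = cong suc (∣∣-sum p)

∣p∣≡∣p∩q∣+∣p∩∁q∣ : (p q : Subset m) → ∣ p ∣ ≡ ∣ p ∩ q ∣ +ℕ ∣ p ∩ ∁ q ∣
∣p∣≡∣p∩q∣+∣p∩∁q∣ []            []            = refl
∣p∣≡∣p∩q∣+∣p∩∁q∣ (outside ∷ p) (_ ∷ q)       = ∣p∣≡∣p∩q∣+∣p∩∁q∣ p q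
∣p∣≡∣p∩q∣+∣p∩∁q∣ (inside ∷ p)  (inside ∷ q)  = cong suc (∣p∣≡∣p∩q∣+∣p∩∁q∣ p q)
∣p∣≡∣p∩q∣+∣p∩∁q∣ (inside ∷ p)  (outside ∷ q) =
  trans (cong suc (∣p∣≡∣p∩q∣+∣p∩∁q∣ p q)) (sym (+-suc _ _))

p⊆q∧∣q∣≤∣p∣⇒p≡q : {p q : Subset m} → p ⊆ q → ∣ q ∣ ≤ ∣ p ∣ → p ≡ q
p⊆q∧∣q∣≤∣p∣⇒p≡q {p = p} {q} p⊆q ∣q∣≤∣p∣ = ⊆-antisym p⊆q λ {x} x∈q →
  decidable-stable (x ∈? p) λ x∉p →
    <⇒≱ (p⊂q⇒∣p∣<∣q∣ (p⊆q , x , x∈q , x∉p)) ∣q∣≤∣p∣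

-- Non-membership is a Boolean equation here, so that pattern matching discards the case where `x`
-- points at an `inside` head of `I`.
∣[I∪⁅x⁆]∩T∣ : ∀ (I T : Subset m) x → lookup I x ≡ false →
              ∣ (I ∪ ⁅ x ⁆) ∩ T ∣ ≡ 𝟙 (lookup T x) +ℕ ∣ I ∩ T ∣
∣[I∪⁅x⁆]∩T∣ (outside ∷ I) (inside ∷ T)  zero    _   rewrite ∪-identityʳ I = refl
∣[I∪⁅x⁆]∩T∣ (outside ∷ I) (outside ∷ T) zero    _   rewrite ∪-identityʳ I = refl
∣[I∪⁅x⁆]∩T∣ (outside ∷ I) (_ ∷ T)       (suc x) x∉I = ∣[I∪⁅x⁆]∩T∣ I T x x∉I
∣[I∪⁅x⁆]∩T∣ (inside ∷ I)  (inside ∷ T)  (suc x) x∉I =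
  trans (cong suc (∣[I∪⁅x⁆]∩T∣ I T x x∉I)) (sym (+-suc (𝟙 (lookup T x)) _))
∣[I∪⁅x⁆]∩T∣ (inside ∷ I)  (outside ∷ T) (suc x) x∉I = ∣[I∪⁅x⁆]∩T∣ I T x x∉I

∉⇒lookup≡false : {p : Subset m} {x : Fin m} → x ∉ p → lookup p x ≡ false
∉⇒lookup≡false {p = p} {x} x∉p with lookup p x in eq
... | true  = contradiction (lookup⇒[]= x p eq) x∉p
... | false = refl

∈-tabulate⁻ : ∀ (f : Fin m → Bool) {x} → x ∈ tabulate f → f x ≡ true
∈-tabulate⁻ f {x} x∈ = trans (sym (lookup∘tabulate f x)) ([]=⇒lookup x∈)

does-true⁻ : (a? : Dec A) → does a? ≡ true → A
does-true⁻ (yes a) _ = a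

∣I∪⁅x⁆∣ : ∀ {I : Subset m} {x} → x ∉ I → ∣ I ∪ ⁅ x ⁆ ∣ ≡ suc ∣ I ∣
∣I∪⁅x⁆∣ {I = I} {x} x∉I = begin
  ∣ I ∪ ⁅ x ⁆ ∣                   ≡⟨ cong ∣_∣ (∩-identityʳ (I ∪ ⁅ x ⁆)) ⟨
  ∣ (I ∪ ⁅ x ⁆) ∩ ⊤ ∣             ≡⟨ ∣[I∪⁅x⁆]∩T∣ I ⊤ x (∉⇒lookup≡false x∉I) ⟩
  𝟙 (lookup ⊤ x) +ℕ ∣ I ∩ ⊤ ∣     ≡⟨ cong₂ (λ b p → 𝟙 b +ℕ ∣ p ∣) ([]=⇒lookup (∈⊤ {x = x})) (∩-identityʳ I) ⟩
  suc ∣ I ∣                       ∎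
  where open ≡-Reasoning

-- Double counting over all subsets.

∑-subsets-suc : ∀ (f : Subset (suc m) → ℕ) →
  ∑ (subsets (suc m)) f ≡ ∑ (subsets m) (f ∘ (outside ∷_)) +ℕ ∑ (subsets m) (f ∘ (inside ∷_))
∑-subsets-suc {m} f = trans (∑-++ (map (outside ∷_) (subsets m)) _ f)
  (cong₂ _+ℕ_ (∑-map (outside ∷_) (subsets m) f) (∑-map (inside ∷_) (subsets m) f))

-- I ↦ I ∪ ⁅ x ⁆ is a bijection from the subsets avoiding x to those containing x.
∑-insert : ∀ (x : Fin m) (g : Subset m → ℕ) →
  ∑ (subsets m) (λ B → 𝟙 (lookup B x) *ℕ g B) ≡
  ∑ (subsets m) (λ I → 𝟙 (not (lookup I x)) *ℕ g (I ∪ ⁅ x ⁆))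
∑-insert {suc m} zero g = begin
  ∑ (subsets (suc m)) f
    ≡⟨ ∑-subsets-suc f ⟩
  ∑ (subsets m) (λ _ → 0) +ℕ ∑ (subsets m) (λ I → 1 *ℕ g (inside ∷ I))
    ≡⟨ +-comm (∑ (subsets m) (λ _ → 0)) _ ⟩
  ∑ (subsets m) (λ I → 1 *ℕ g (inside ∷ I)) +ℕ ∑ (subsets m) (λ _ → 0)
    ≡⟨ cong (_+ℕ ∑ (subsets m) (λ _ → 0))
         (∑-cong (subsets m) λ I → cong (λ J → 1 *ℕ g (inside ∷ J)) (sym (∪-identityʳ I))) ⟩
  ∑ (subsets m) (h ∘ (outside ∷_)) +ℕ ∑ (subsets m) (h ∘ (inside ∷_))
    ≡⟨ ∑-subsets-suc h ⟨
  ∑ (subsets (suc m)) h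
    ∎
  where
  open ≡-Reasoning
  f h : Subset (suc m) → ℕ
  f B = 𝟙 (lookup B zero) *ℕ g B
  h I = 𝟙 (not (lookup I zero)) *ℕ g (I ∪ ⁅ zero ⁆)
∑-insert {suc m} (suc x) g =
  trans (∑-subsets-suc (λ B → 𝟙 (lookup B (suc x)) *ℕ g B))
  (trans (cong₂ _+ℕ_ (∑-insert x (g ∘ (outside ∷_))) (∑-insert x (g ∘ (inside ∷_))))
  (sym (∑-subsets-suc (λ I → 𝟙 (not (lookup I (suc x))) *ℕ g (I ∪ ⁅ suc x ⁆)))))

-- When `P` tests for bases, this is the complement of the hyperplane spanned by `I` if `I` is
-- independent of size one below the rank, and empty otherwise.
extensions : (Subset m → Bool) → Subset m → Subset m
extensions P I = tabulate λ x → not (lookup I x) ∧ P (I ∪ ⁅ x ⁆)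

-- Both sides count, with weights, the pairs (I , x) with x ∈ T ∖ I and P (I ∪ ⁅ x ⁆).
∑-extensions : ∀ (P : Subset m → Bool) (T : Subset m) (u v : Subset m → ℕ) →
  (∀ I x → lookup T x ≡ true → lookup I x ≡ false → v (I ∪ ⁅ x ⁆) ≡ u I) →
  ∑ (subsets m) (λ B → (𝟙 (P B) *ℕ v B) *ℕ ∣ B ∩ T ∣) ≡
  ∑ (subsets m) (λ I → u I *ℕ ∣ extensions P I ∩ T ∣)
∑-extensions {m} P T u v v≡u = begin
  ∑ (subsets m) (λ B → w B *ℕ ∣ B ∩ T ∣)
    ≡⟨ ∑-cong (subsets m) (λ B → weighted-card (w B) (B ∩ T)) ⟩
  ∑ (subsets m) (λ B → Fin∑.sum (λ x → w B *ℕ 𝟙 (lookup (B ∩ T) x)))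
    ≡⟨ ∑-Fin∑-comm (subsets m) (λ B x → w B *ℕ 𝟙 (lookup (B ∩ T) x)) ⟩
  Fin∑.sum (λ x → ∑ (subsets m) (λ B → w B *ℕ 𝟙 (lookup (B ∩ T) x)))
    -- With the sums exchanged, `x` is fixed, and `∑-insert` passes from the sets `B` containing `x`
    -- to the sets `I` avoiding it.
    ≡⟨ Fin∑.sum-cong-≗ (λ x → fixed x) ⟩
  Fin∑.sum (λ x → ∑ (subsets m) (λ I → u I *ℕ 𝟙 (lookup (extensions P I ∩ T) x)))
    ≡⟨ ∑-Fin∑-comm (subsets m) (λ I x → u I *ℕ 𝟙 (lookup (extensions P I ∩ T) x)) ⟨
  ∑ (subsets m) (λ I → Fin∑.sum (λ x → u I *ℕ 𝟙 (lookup (extensions P I ∩ T) x)))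
    ≡⟨ ∑-cong (subsets m) (λ I → weighted-card (u I) (extensions P I ∩ T)) ⟨
  ∑ (subsets m) (λ I → u I *ℕ ∣ extensions P I ∩ T ∣)
    ∎
  where
  open ≡-Reasoning
  w : Subset m → ℕ
  w B = 𝟙 (P B) *ℕ v B
  weighted-card : ∀ c (p : Subset m) → c *ℕ ∣ p ∣ ≡ Fin∑.sum (λ x → c *ℕ 𝟙 (lookup p x))
  weighted-card c p = trans (cong (c *ℕ_) (∣∣-sum p)) (Fin∑.*-distribˡ-sum c (𝟙 ∘ lookup p))
  before : ∀ x B → w B *ℕ 𝟙 (lookup (B ∩ T) x) ≡ 𝟙 (lookup B x) *ℕ (w B *ℕ 𝟙 (lookup T x))
  before x B = begin
    w B *ℕ 𝟙 (lookup (B ∩ T) x)              ≡⟨ cong (λ b → w B *ℕ 𝟙 b) (lookup-zipWith _∧_ x B T) ⟩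
    w B *ℕ 𝟙 (lookup B x ∧ lookup T x)       ≡⟨ cong (w B *ℕ_) (𝟙-∧ (lookup B x) (lookup T x)) ⟩
    w B *ℕ (𝟙 (lookup B x) *ℕ 𝟙 (lookup T x)) ≡⟨ solve 3 (λ a b c → a :* (b :* c) := b :* (a :* c)) refl
                                                  (w B) (𝟙 (lookup B x)) (𝟙 (lookup T x)) ⟩
    𝟙 (lookup B x) *ℕ (w B *ℕ 𝟙 (lookup T x)) ∎
    where open +-*-Solver
  after : ∀ x I → 𝟙 (not (lookup I x)) *ℕ (w (I ∪ ⁅ x ⁆) *ℕ 𝟙 (lookup T x)) ≡
                  u I *ℕ 𝟙 (lookup (extensions P I ∩ T) x)
  after x I rewrite lookup-zipWith _∧_ x (extensions P I) T
                  | lookup∘tabulate (λ y → not (lookup I y) ∧ P (I ∪ ⁅ y ⁆)) x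
    with lookup I x in x∉I | lookup T x in x∈T
  ... | true  | _     = sym (*-zeroʳ (u I))
  ... | false | false rewrite 𝟙-∧ (P (I ∪ ⁅ x ⁆)) false | *-zeroʳ (𝟙 (P (I ∪ ⁅ x ⁆)))
                            | *-zeroʳ (u I) | *-zeroʳ (w (I ∪ ⁅ x ⁆)) = refl
  ... | false | true  rewrite v≡u I x x∈T x∉I | 𝟙-∧ (P (I ∪ ⁅ x ⁆)) true =
    solve 2 (λ a b → con 1 :* ((a :* b) :* con 1) := b :* (a :* con 1)) refl (𝟙 (P (I ∪ ⁅ x ⁆))) (u I)
    where open +-*-Solver
  fixed : ∀ x → ∑ (subsets m) (λ B → w B *ℕ 𝟙 (lookup (B ∩ T) x)) ≡
                ∑ (subsets m) (λ I → u I *ℕ 𝟙 (lookup (extensions P I ∩ T) x))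
  fixed x = trans (∑-cong (subsets m) (before x))
    (trans (∑-insert x (λ B → w B *ℕ 𝟙 (lookup T x))) (∑-cong (subsets m) (after x)))

-- Saturated sets of a balanced partition.

module _ (class : Fin m → Subset m)
         (∈-class : ∀ x → x ∈ class x)
         (class-eucl : ∀ {x y z} → z ∈ class x → z ∈ class y → y ∈ class x)
         (R Q : Subset m) (r q : ℕ)
         (class-balanced : ∀ x → ∣ class x ∩ R ∣ *ℕ r ≡ ∣ class x ∩ Q ∣ *ℕ q)
         where

  private
    peel : ∀ {S c : Subset m} → c ⊆ S → ∀ T → ∣ S ∩ T ∣ ≡ ∣ c ∩ T ∣ +ℕ ∣ (S ∩ ∁ c) ∩ T ∣
    peel {S} {c} c⊆S T = trans (∣p∣≡∣p∩q∣+∣p∩∁q∣ (S ∩ T) c)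
      (cong₂ (λ a b → ∣ a ∣ +ℕ ∣ b ∣)
        (⊆-antisym
          (λ i → let j , k = x∈p∩q⁻ _ c i in x∈p∩q⁺ (k , proj₂ (x∈p∩q⁻ S T j)))
          (λ i → let j , k = x∈p∩q⁻ c T i in x∈p∩q⁺ (x∈p∩q⁺ (c⊆S j , k) , j)))
        (⊆-antisym
          (λ i → let j , k = x∈p∩q⁻ _ (∁ c) i ; s , t = x∈p∩q⁻ S T j in x∈p∩q⁺ (x∈p∩q⁺ (s , k) , t))
          (λ i → let j , t = x∈p∩q⁻ _ T i ; s , k = x∈p∩q⁻ S (∁ c) j in x∈p∩q⁺ (x∈p∩q⁺ (s , t) , k))))

  -- Reflexivity and the Euclidean law make membership in `class` an equivalence relation, so a
  -- saturated set is a disjoint union of classes. Peeling off one class leaves a smaller saturated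
  -- set, and the balances of the classes add up.
  saturated-balanced : ∀ S → (∀ {x} → x ∈ S → class x ⊆ S) →
                       ∣ S ∩ R ∣ *ℕ r ≡ ∣ S ∩ Q ∣ *ℕ q
  saturated-balanced S = go S (<-wellFounded ∣ S ∣)
    where
    go : ∀ S → Acc _<_ ∣ S ∣ → (∀ {x} → x ∈ S → class x ⊆ S) →
         ∣ S ∩ R ∣ *ℕ r ≡ ∣ S ∩ Q ∣ *ℕ q
    go S (acc rec) sat with nonempty? S
    ... | no empty rewrite Empty-unique empty | ∩-zeroˡ R | ∩-zeroˡ Q | ∣⊥∣≡0 m = refl
    ... | yes (x , x∈S) = begin
      ∣ S ∩ R ∣ *ℕ r                                ≡⟨ cong (_*ℕ r) (peel (sat x∈S) R) ⟩
      (∣ class x ∩ R ∣ +ℕ ∣ S′ ∩ R ∣) *ℕ r          ≡⟨ *-distribʳ-+ r ∣ class x ∩ R ∣ _ ⟩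
      ∣ class x ∩ R ∣ *ℕ r +ℕ ∣ S′ ∩ R ∣ *ℕ r       ≡⟨ cong₂ _+ℕ_ (class-balanced x) (go S′ (rec smaller) sat′) ⟩
      ∣ class x ∩ Q ∣ *ℕ q +ℕ ∣ S′ ∩ Q ∣ *ℕ q       ≡⟨ *-distribʳ-+ q ∣ class x ∩ Q ∣ _ ⟨
      (∣ class x ∩ Q ∣ +ℕ ∣ S′ ∩ Q ∣) *ℕ q          ≡⟨ cong (_*ℕ q) (peel (sat x∈S) Q) ⟨
      ∣ S ∩ Q ∣ *ℕ q                                ∎
      where
      open ≡-Reasoning
      S′ = S ∩ ∁ (class x)
      smaller : ∣ S′ ∣ < ∣ S ∣
      smaller = p⊂q⇒∣p∣<∣q∣ (p∩q⊆p S _ , x , x∈S , λ x∈S′ →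
        x∈∁p⇒x∉p (proj₂ (x∈p∩q⁻ S _ x∈S′)) (∈-class x))
      sat′ : ∀ {y} → y ∈ S′ → class y ⊆ S′
      sat′ y∈S′ z∈cy = let y∈S , y∉cx = x∈p∩q⁻ S _ y∈S′ in
        -- A common element `z` of the two classes would put `y` into the class just removed.
        x∈p∩q⁺ (sat y∈S z∈cy , x∉p⇒x∈∁p λ z∈cx → x∈∁p⇒x∉p y∉cx (class-eucl z∈cx z∈cy))

-- Rank, bases and augmentation.

∈-subsets : (p : Subset m) → p ∈ˡ subsets m
∈-subsets []            = here refl
∈-subsets (outside ∷ p) = ∈-++⁺ˡ (∈-map⁺ (outside ∷_) (∈-subsets p))
∈-subsets {suc m} (inside ∷ p) =
  ∈-++⁺ʳ (map (outside ∷_) (subsets m)) (∈-map⁺ (inside ∷_) (∈-subsets p))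

∪-⊆ : {p q s : Subset m} → p ⊆ s → q ⊆ s → p ∪ q ⊆ s
∪-⊆ {p = p} {q} p⊆s q⊆s x∈ with x∈p∪q⁻ p q x∈
... | inj₁ x∈p = p⊆s x∈p
... | inj₂ x∈q = q⊆s x∈q

⁅⁆-⊆ : {x : Fin m} {p : Subset m} → x ∈ p → ⁅ x ⁆ ⊆ p
⁅⁆-⊆ {x = x} {p} x∈p y∈ = subst (_∈ p) (sym (x∈⁅y⁆⇒x≡y x y∈)) x∈p

module _ (M : Matroid m) where
  open Matroid M

  ∣I∣≤rank : ∀ {I S} → Indep I → I ⊆ S → ∣ I ∣ ≤ rank M S
  ∣I∣≤rank {I} {S} indI I⊆S = All.lookup (xs≤max 0 _)
    (∈-map⁺ ∣_∣ (∈-filter⁺ (λ J → indep? J ×-dec J ⊆? S) (∈-subsets I) (indI , I⊆S)))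

  rank-attained : ∀ S → ∃ λ I → Indep I × I ⊆ S × ∣ I ∣ ≡ rank M S
  rank-attained S
    with argmax-sel id 0 (map ∣_∣ (filter (λ J → indep? J ×-dec J ⊆? S) (subsets m)))
  -- Here the maximum is the default value 0, which the empty set attains.
  ... | inj₁ rank≡0 = ⊥ , ⊥-indep , ⊥⊆ , trans (∣⊥∣≡0 m) (sym rank≡0)
  ... | inj₂ rank∈ with ∈-map⁻ ∣_∣ rank∈
  ...   | I , I∈ , rank≡∣I∣
      with ∈-filter⁻ (λ J → indep? J ×-dec J ⊆? S) {xs = subsets m} I∈
  ...     | _ , indI , I⊆S = I , indI , I⊆S , sym rank≡∣I∣

  -- If `B` were smaller than an independent set of full rank, augmentation would enlarge it,
  -- against maximality.
  base⇒∣B∣≡rk : ∀ {B} → Base M B → ∣ B ∣ ≡ rk M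
  base⇒∣B∣≡rk {B} (indB , maxB) with rank-attained ⊤
  ... | J , indJ , _ , ∣J∣≡rk = ≤-antisym (∣I∣≤rank indB ⊆⊤) (≮⇒≥ λ ∣B∣<rk →
    let x , _ , x∉B , indB+x = augment indB indJ (subst (∣ B ∣ <_) (sym ∣J∣≡rk) ∣B∣<rk)
    in maxB (_ , indB+x , p⊆p∪q ⁅ x ⁆ , x , q⊆p∪q B ⁅ x ⁆ (x∈⁅x⁆ x) , x∉B))

  -- A strictly larger independent set would have more elements than the rank allows.
  ∣B∣≡rk⇒base : ∀ {B} → Indep B → ∣ B ∣ ≡ rk M → Base M B
  ∣B∣≡rk⇒base {B} indB ∣B∣≡rk = indB , λ (I , indI , B⊂I) →
    <⇒≱ (p⊂q⇒∣p∣<∣q∣ B⊂I) (subst (∣ I ∣ ≤_) (sym ∣B∣≡rk) (∣I∣≤rank indI ⊆⊤))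

  -- The difference d bounds the number of augmentation steps.
  extend-within : ∀ d {I J} → Indep I → Indep J → ∣ J ∣ ≤ d +ℕ ∣ I ∣ →
                  ∃ λ K → Indep K × I ⊆ K × K ⊆ I ∪ J × ∣ J ∣ ≤ ∣ K ∣
  extend-within zero {I} {J} indI _ ∣J∣≤∣I∣ = I , indI , ⊆-refl , p⊆p∪q J , ∣J∣≤∣I∣
  extend-within (suc d) {I} {J} indI indJ ∣J∣≤ with ∣ J ∣ ℕ.≤? ∣ I ∣
  ... | yes ∣J∣≤∣I∣ = I , indI , ⊆-refl , p⊆p∪q J , ∣J∣≤∣I∣
  ... | no ∣J∣≰∣I∣ =
    let x , x∈J , x∉I , indI+x = augment indI indJ (≰⇒> ∣J∣≰∣I∣)
        K , indK , I+x⊆K , K⊆ , ∣J∣≤∣K∣ = extend-within d indI+x indJ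
          (subst (∣ J ∣ ≤_) (trans (sym (+-suc d _)) (cong (d +ℕ_) (sym (∣I∪⁅x⁆∣ x∉I)))) ∣J∣≤)
    in K , indK , ⊆-trans (p⊆p∪q ⁅ x ⁆) I+x⊆K
         , ⊆-trans K⊆ (∪-⊆ (∪-⊆ (p⊆p∪q J) (⊆-trans (⁅⁆-⊆ x∈J) (q⊆p∪q I J))) (q⊆p∪q I J))
         , ∣J∣≤∣K∣

  -- Parallel classes in a loopless matroid.

  module _ (loopless : Loopless M) where

    ⁅⁆-indep : ∀ x → Indep ⁅ x ⁆
    ⁅⁆-indep x = decidable-stable (indep? ⁅ x ⁆) (loopless x)

    rank-⁅⁆ : ∀ x → rank M ⁅ x ⁆ ≡ 1
    rank-⁅⁆ x with rank-attained ⁅ x ⁆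
    ... | I , _ , I⊆x , ∣I∣≡rank = ≤-antisym
      (subst₂ _≤_ ∣I∣≡rank (∣⁅x⁆∣≡1 x) (p⊆q⇒∣p∣≤∣q∣ I⊆x))
      (subst (_≤ rank M ⁅ x ⁆) (∣⁅x⁆∣≡1 x) (∣I∣≤rank (⁅⁆-indep x) ⊆-refl))

    ∣pair∣ : ∀ {x y : Fin m} → x ≢ y → ∣ ⁅ x ⁆ ∪ ⁅ y ⁆ ∣ ≡ 2
    ∣pair∣ {x} x≢y = trans (∣I∪⁅x⁆∣ (x≢y⇒x∉⁅y⁆ (x≢y ∘ sym))) (cong suc (∣⁅x⁆∣≡1 x))

    -- Without loops a singleton has rank 1, and adding an element of its closure keeps that rank,
    -- which leaves no room for two independent elements.
    ∈closure⇒dependent : ∀ {x y} → y ∈ closure M ⁅ x ⁆ → x ≢ y → ¬ Indep (⁅ x ⁆ ∪ ⁅ y ⁆)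
    ∈closure⇒dependent {x} {y} y∈cl x≢y ind
      with subst₂ _≤_ (∣pair∣ x≢y) (trans same-rank (rank-⁅⁆ x)) (∣I∣≤rank ind ⊆-refl)
      where
      same-rank : rank M (⁅ x ⁆ ∪ ⁅ y ⁆) ≡ rank M ⁅ x ⁆
      same-rank = does-true⁻ (_ ℕ.≟ _) (∈-tabulate⁻ _ y∈cl)
    ... | s≤s ()

    -- Rank 2 would be attained only by the whole pair. The guard `x ≢ y` is essential to the form:
    -- for `x` equal to `y` the union is a singleton, which is independent although `x` lies in its
    -- own closure.
    dependent⇒∈closure : ∀ {x y} → (x ≢ y → ¬ Indep (⁅ x ⁆ ∪ ⁅ y ⁆)) → y ∈ closure M ⁅ x ⁆
    dependent⇒∈closure {x} {y} dep = lookup⇒[]= y _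
      (trans (lookup∘tabulate _ y) (dec-true (_ ℕ.≟ _) (trans rank≡1 (sym (rank-⁅⁆ x)))))
      where
      rank≤1 : rank M (⁅ x ⁆ ∪ ⁅ y ⁆) ≤ 1
      rank≤1 with rank-attained (⁅ x ⁆ ∪ ⁅ y ⁆) | x Fin.≟ y
      ... | I , indI , I⊆ , ∣I∣≡ | yes refl =
        subst₂ _≤_ ∣I∣≡ (∣⁅x⁆∣≡1 x) (p⊆q⇒∣p∣≤∣q∣ (⊆-trans I⊆ (∪-⊆ ⊆-refl ⊆-refl)))
      ... | I , indI , I⊆ , ∣I∣≡ | no x≢y = ≮⇒≥ λ 1<rank → dep x≢y
        (subst Indep (p⊆q∧∣q∣≤∣p∣⇒p≡q I⊆ (subst₂ _≤_ (sym (∣pair∣ x≢y)) (sym ∣I∣≡) 1<rank)) indI)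
      rank≡1 : rank M (⁅ x ⁆ ∪ ⁅ y ⁆) ≡ 1
      rank≡1 = ≤-antisym rank≤1
        (subst (_≤ rank M (⁅ x ⁆ ∪ ⁅ y ⁆)) (∣⁅x⁆∣≡1 x) (∣I∣≤rank (⁅⁆-indep x) (p⊆p∪q ⁅ y ⁆)))

    ∈-closure-⁅⁆ : ∀ x → x ∈ closure M ⁅ x ⁆
    ∈-closure-⁅⁆ x = dependent⇒∈closure λ x≢x → contradiction refl x≢x

    -- An independent pair x , y would augment z to a pair independent of z.
    closure-⁅⁆-eucl : ∀ {x y z} → z ∈ closure M ⁅ x ⁆ → z ∈ closure M ⁅ y ⁆ → y ∈ closure M ⁅ x ⁆
    closure-⁅⁆-eucl {x} {y} {z} z∈x z∈y = dependent⇒∈closure λ x≢y indxy →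
      let w , w∈xy , w∉z , indzw = augment (⁅⁆-indep z) indxy
            (subst₂ _<_ (sym (∣⁅x⁆∣≡1 z)) (sym (∣pair∣ x≢y)) ≤-refl)
          refute : ∀ {v} → z ∈ closure M ⁅ v ⁆ → w ∉ ⁅ v ⁆
          refute {v} z∈v w∈v = ∈closure⇒dependent
            (subst (λ t → z ∈ closure M ⁅ t ⁆) (sym (x∈⁅y⁆⇒x≡y v w∈v)) z∈v)
            (x∉⁅y⁆⇒x≢y w∉z) (subst Indep (∪-comm ⁅ z ⁆ ⁅ w ⁆) indzw)
      in case x∈p∪q⁻ ⁅ x ⁆ ⁅ y ⁆ w∈xy of λ where
        (inj₁ w∈x) → refute z∈x w∈x
        (inj₂ w∈y) → refute z∈y w∈y

    ∈-independent⇒∉closure : ∀ {B x y} → Indep B → x ∈ B → y ∈ B → x ≢ y → y ∉ closure M ⁅ x ⁆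
    ∈-independent⇒∉closure indB x∈B y∈B x≢y y∈cl = ∈closure⇒dependent y∈cl x≢y
      (hereditary (∪-⊆ (⁅⁆-⊆ x∈B) (⁅⁆-⊆ y∈B)) indB)

    -- Grow `y` to the size of a base using elements of `I` and `x`. Since `x` is parallel to `y` it
    -- can never be taken, so the result is forced to be `I ∪ ⁅ y ⁆`.
    exchange-parallel : ∀ {I x y} → x ∉ I → Base M (I ∪ ⁅ x ⁆) → y ∈ closure M ⁅ x ⁆ →
                        y ∉ I × Base M (I ∪ ⁅ y ⁆)
    exchange-parallel {I} {x} {y} x∉I baseI+x y∈cl = y∉I , baseI+y
      where
      indI+x = proj₁ baseI+x
      x∈I+x : x ∈ I ∪ ⁅ x ⁆
      x∈I+x = q⊆p∪q I ⁅ x ⁆ (x∈⁅x⁆ x)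
      y∉I : y ∉ I
      y∉I y∈I = ∈-independent⇒∉closure indI+x x∈I+x (p⊆p∪q ⁅ x ⁆ y∈I)
        (λ x≡y → x∉I (subst (_∈ I) (sym x≡y) y∈I)) y∈cl
      baseI+y : Base M (I ∪ ⁅ y ⁆)
      baseI+y with x Fin.≟ y
      ... | yes refl = baseI+x
      ... | no x≢y =
        let J = I ∪ ⁅ x ⁆
            -- The number of steps allowed is `∣ J ∣`, a crude bound that always suffices.
            K , indK , y⊆K , K⊆y+J , ∣J∣≤∣K∣ = extend-within ∣ J ∣ (⁅⁆-indep y) indI+x (m≤m+n ∣ J ∣ _)
            ∣J∣≡ = ∣I∪⁅x⁆∣ x∉I
            ∣I+y∣≡ = ∣I∪⁅x⁆∣ y∉I
            x∉K : x ∉ K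
            x∉K x∈K = ∈-independent⇒∉closure indK x∈K (y⊆K (x∈⁅x⁆ y)) x≢y y∈cl
            K⊆I+y : K ⊆ I ∪ ⁅ y ⁆
            K⊆I+y {z} z∈K = case x∈p∪q⁻ ⁅ y ⁆ J (K⊆y+J z∈K) of λ where
              (inj₁ z∈y) → q⊆p∪q I ⁅ y ⁆ z∈y
              (inj₂ z∈J) → case x∈p∪q⁻ I ⁅ x ⁆ z∈J of λ where
                (inj₁ z∈I) → p⊆p∪q ⁅ y ⁆ z∈I
                (inj₂ z∈x) → contradiction (subst (_∈ K) (x∈⁅y⁆⇒x≡y x z∈x) z∈K) x∉K
            ∣I+y∣≡∣J∣ = trans ∣I+y∣≡ (sym ∣J∣≡)
            -- `K` lies inside a set of the size of `J` and has at least that size itself.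
            K≡I+y = p⊆q∧∣q∣≤∣p∣⇒p≡q K⊆I+y (subst (_≤ ∣ K ∣) (sym ∣I+y∣≡∣J∣) ∣J∣≤∣K∣)
        in ∣B∣≡rk⇒base (subst Indep K≡I+y indK) (trans ∣I+y∣≡∣J∣ (base⇒∣B∣≡rk baseI+x))

    -- One-element extensions to bases.

    baseExtensions : Subset m → Subset m
    baseExtensions = extensions (does ∘ base? M)

    ∈-baseExtensions⁻ : ∀ {I x} → x ∈ baseExtensions I → x ∉ I × Base M (I ∪ ⁅ x ⁆)
    ∈-baseExtensions⁻ {I} {x} x∈ =
      (λ x∈I → case trans (cong not (sym ([]=⇒lookup x∈I))) (∧-conicalˡ _ _ ext) of λ ()) ,
      does-true⁻ (base? M (I ∪ ⁅ x ⁆)) (∧-conicalʳ (not (lookup I x)) _ ext)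
      where
      ext : not (lookup I x) ∧ does (base? M (I ∪ ⁅ x ⁆)) ≡ true
      ext = ∈-tabulate⁻ (λ z → not (lookup I z) ∧ does (base? M (I ∪ ⁅ z ⁆))) x∈

    ∈-baseExtensions⁺ : ∀ {I x} → x ∉ I → Base M (I ∪ ⁅ x ⁆) → x ∈ baseExtensions I
    ∈-baseExtensions⁺ {I} {x} x∉I base = lookup⇒[]= x _ (trans (lookup∘tabulate _ x)
      (cong₂ (λ a b → not a ∧ b) (∉⇒lookup≡false x∉I) (dec-true (base? M _) base)))

    baseExtensions-saturated : ∀ I {x} → x ∈ baseExtensions I → closure M ⁅ x ⁆ ⊆ baseExtensions I
    baseExtensions-saturated I {x} x∈ {y} y∈cl =
      let x∉I , base = ∈-baseExtensions⁻ {I} {x} x∈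
          y∉I , base′ = exchange-parallel x∉I base y∈cl
      in ∈-baseExtensions⁺ {I} {y} y∉I base′

  -- Counting bases by their intersection with `R`.

  N-∑ : ∀ R k → N M R k ≡ ∑ (subsets m) (λ B → 𝟙 (does (base? M B)) *ℕ 𝟙 (does (∣ B ∩ R ∣ ℕ.≟ k)))
  N-∑ R k = trans (length-filter-∑ _ (subsets m)) (∑-cong (subsets m) λ B → 𝟙-∧ (does (base? M B)) _)

  module _ (R : Subset m) where
    private
      w : ℕ → Subset m → ℕ
      w k B = 𝟙 (does (∣ B ∩ R ∣ ℕ.≟ k))

      -- On every base counted by `N M R k` the intersection with `T` has constant size `c`, and all
      -- other sets have weight 0. The constant can thus become `∣ B ∩ T ∣`, the form that
      -- `∑-extensions` takes.
      *-N : ∀ c k T → (∀ B → Base M B → ∣ B ∩ R ∣ ≡ k → ∣ B ∩ T ∣ ≡ c) →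
            c *ℕ N M R k ≡ ∑ (subsets m) (λ B → (𝟙 (does (base? M B)) *ℕ w k B) *ℕ ∣ B ∩ T ∣)
      *-N c k T card = trans (cong (c *ℕ_) (N-∑ R k)) (trans (*-distribˡ-∑ c (subsets m) _)
        (∑-cong (subsets m) λ B → *-𝟙-cong (base? M B) (∣ B ∩ R ∣ ℕ.≟ k) (card B)))

    -- A base with `suc k` elements in `R` loses one of them in `suc k` ways, each leaving a set
    -- with `k` elements in `R`.
    suc-*-N : ∀ k → suc k *ℕ N M R (suc k) ≡
              ∑ (subsets m) (λ I → w k I *ℕ ∣ extensions (does ∘ base? M) I ∩ R ∣)
    suc-*-N k = trans (*-N (suc k) (suc k) R λ _ _ eq → eq)
      (∑-extensions (does ∘ base? M) R (w k) (w (suc k)) λ I x x∈R x∉I →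
        -- Inserting `x` from `R` raises the count by one, and the test of `suc a` against `suc k`
        -- reduces to that of `a` against `k`.
        cong (λ c → 𝟙 (does (c ℕ.≟ suc k)))
          (trans (∣[I∪⁅x⁆]∩T∣ I R x x∉I) (cong (λ b → 𝟙 b +ℕ ∣ I ∩ R ∣) x∈R)))

    -- Removing an element outside `R` does not change the count in `R`, so the weight is `w k` on
    -- both sides. All bases have size `rk M`, which fixes the number of elements available for
    -- removal.
    rk∸-*-N : ∀ k → (rk M ∸ k) *ℕ N M R k ≡
              ∑ (subsets m) (λ I → w k I *ℕ ∣ extensions (does ∘ base? M) I ∩ ∁ R ∣)
    rk∸-*-N k = trans (*-N (rk M ∸ k) k (∁ R) complement)
      (∑-extensions (does ∘ base? M) (∁ R) (w k) (w k) λ I x x∈∁R x∉I →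
        cong (λ c → 𝟙 (does (c ℕ.≟ k)))
          (trans (∣[I∪⁅x⁆]∩T∣ I R x x∉I)
            (cong (λ b → 𝟙 b +ℕ ∣ I ∩ R ∣)
              (∉⇒lookup≡false (x∈∁p⇒x∉p (lookup⇒[]= x (∁ R) x∈∁R))))))
      where
      complement : ∀ B → Base M B → ∣ B ∩ R ∣ ≡ k → ∣ B ∩ ∁ R ∣ ≡ rk M ∸ k
      complement B base refl = sym (trans
        (cong (_∸ ∣ B ∩ R ∣) (trans (sym (base⇒∣B∣≡rk base)) (∣p∣≡∣p∩q∣+∣p∩∁q∣ B R)))
        (m+n∸m≡n ∣ B ∩ R ∣ _))

    module _ (loopless : Loopless M) (r q : ℕ)
             (balanced : ∀ x → ∣ closure M ⁅ x ⁆ ∩ R ∣ *ℕ r ≡ ∣ closure M ⁅ x ⁆ ∩ ∁ R ∣ *ℕ q) where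

      -- Both counts become sums over `I` with the same weight `w k I`, so the balance of each set
      -- of extensions can be applied term by term.
      N-recurrence : ∀ k → r *ℕ (suc k *ℕ N M R (suc k)) ≡ q *ℕ ((rk M ∸ k) *ℕ N M R k)
      N-recurrence k = begin
        r *ℕ (suc k *ℕ N M R (suc k))
          ≡⟨ cong (r *ℕ_) (suc-*-N k) ⟩
        r *ℕ ∑ (subsets m) (λ I → w k I *ℕ ∣ ext I ∩ R ∣)
          ≡⟨ *-distribˡ-∑ r (subsets m) _ ⟩
        ∑ (subsets m) (λ I → r *ℕ (w k I *ℕ ∣ ext I ∩ R ∣))
          ≡⟨ ∑-cong (subsets m) (λ I → trans (shuffle r (w k I) ∣ ext I ∩ R ∣)
               (trans (cong (w k I *ℕ_) (ext-balanced I)) (sym (shuffle q (w k I) ∣ ext I ∩ ∁ R ∣)))) ⟩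
        ∑ (subsets m) (λ I → q *ℕ (w k I *ℕ ∣ ext I ∩ ∁ R ∣))
          ≡⟨ *-distribˡ-∑ q (subsets m) _ ⟨
        q *ℕ ∑ (subsets m) (λ I → w k I *ℕ ∣ ext I ∩ ∁ R ∣)
          ≡⟨ cong (q *ℕ_) (rk∸-*-N k) ⟨
        q *ℕ ((rk M ∸ k) *ℕ N M R k)
          ∎
        where
        open ≡-Reasoning
        ext = baseExtensions loopless
        shuffle : ∀ a b c → a *ℕ (b *ℕ c) ≡ b *ℕ (c *ℕ a)
        shuffle = solve 3 (λ a b c → a :* (b :* c) := b :* (c :* a)) refl
          where open +-*-Solver
        ext-balanced : ∀ I → ∣ ext I ∩ R ∣ *ℕ r ≡ ∣ ext I ∩ ∁ R ∣ *ℕ q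
        ext-balanced I = saturated-balanced (λ x → closure M ⁅ x ⁆)
          (∈-closure-⁅⁆ loopless) (closure-⁅⁆-eucl loopless) R (∁ R) r q balanced
          (ext I) (baseExtensions-saturated loopless I)

-- Ratios of consecutive binomial coefficients.

-- Stated additively so that the induction needs no hypothesis k ≤ n.
C-absorption : ∀ n k → suc k *ℕ (n C suc k) +ℕ k *ℕ (n C k) ≡ n *ℕ (n C k)
C-absorption zero    zero    = refl
C-absorption zero    (suc k) rewrite *-zeroʳ k = refl
C-absorption (suc n) zero    = begin
  1 *ℕ (suc n C 1) +ℕ 0     ≡⟨ solve 1 (λ a → con 1 :* a :+ con 0 := a) refl (suc n C 1) ⟩
  suc n C 1                 ≡⟨ nC1≡n (suc n) ⟩
  suc n                     ≡⟨ *-identityʳ (suc n) ⟨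
  suc n *ℕ 1                ∎
  where open ≡-Reasoning
        open +-*-Solver
C-absorption (suc n) (suc k) = begin
  suc (suc k) *ℕ (suc n C suc (suc k)) +ℕ suc k *ℕ (suc n C suc k)
    ≡⟨ cong₂ (λ x y → suc (suc k) *ℕ x +ℕ suc k *ℕ y)
         (nCk+nC[k+1]≡[n+1]C[k+1] n (suc k)) (nCk+nC[k+1]≡[n+1]C[k+1] n k) ⟨
  suc (suc k) *ℕ (b +ℕ c) +ℕ suc k *ℕ (a +ℕ b)
    ≡⟨ solve 4 (λ k a b c → (con 2 :+ k) :* (b :+ c) :+ (con 1 :+ k) :* (a :+ b) :=
         ((con 2 :+ k) :* c :+ (con 1 :+ k) :* b) :+ ((con 1 :+ k) :* b :+ k :* a) :+ (a :+ b)) refl k a b c ⟩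
  (suc (suc k) *ℕ c +ℕ suc k *ℕ b) +ℕ (suc k *ℕ b +ℕ k *ℕ a) +ℕ (a +ℕ b)
    ≡⟨ cong₂ (λ x y → x +ℕ y +ℕ (a +ℕ b)) (C-absorption n (suc k)) (C-absorption n k) ⟩
  n *ℕ b +ℕ n *ℕ a +ℕ (a +ℕ b)
    ≡⟨ solve 3 (λ n a b → n :* b :+ n :* a :+ (a :+ b) := (con 1 :+ n) :* (a :+ b)) refl n a b ⟩
  suc n *ℕ (a +ℕ b)
    ≡⟨ cong (suc n *ℕ_) (nCk+nC[k+1]≡[n+1]C[k+1] n k) ⟩
  suc n *ℕ (suc n C suc k)
    ∎
  where
  open ≡-Reasoning
  open +-*-Solver
  a = n C k
  b = n C suc k
  c = n C suc (suc k)

-- Subtract `k *ℕ (n C k)` from the additive form. Truncation does no harm: once `k` reaches `n`,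
-- both sides are 0.
suc-*-C : ∀ n k → suc k *ℕ (n C suc k) ≡ (n ∸ k) *ℕ (n C k)
suc-*-C n k = begin
  suc k *ℕ (n C suc k)                               ≡⟨ m+n∸n≡m _ (k *ℕ (n C k)) ⟨
  suc k *ℕ (n C suc k) +ℕ k *ℕ (n C k) ∸ k *ℕ (n C k) ≡⟨ cong (_∸ k *ℕ (n C k)) (C-absorption n k) ⟩
  n *ℕ (n C k) ∸ k *ℕ (n C k)                        ≡⟨ *-distribʳ-∸ (n C k) n k ⟨
  (n ∸ k) *ℕ (n C k)                                 ∎
  where open ≡-Reasoning

-- Rational quotients and the geometric progression.

-- Since `_/_` reduces to lowest terms, the equation is transported to unnormalised fractions, where
-- it is plain cross-multiplication.
/-≡-*-/ : ∀ a b q r c d .{{b≢0 : NonZero b}} .{{_ : NonZero r}} .{{d≢0 : NonZero d}} →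
          a *ℕ (r *ℕ d) ≡ (q *ℕ c) *ℕ b → + a / b ≡ (+ q / r) * (+ c / d)
/-≡-*-/ a b@(suc _) q r@(suc _) c d@(suc _) eq = ℚ.toℚᵘ-injective (begin
  toℚᵘ (+ a / b)                        ≈⟨ ℚ.toℚᵘ-fromℚᵘ (+ a ℚᵘ./ b) ⟩
  + a ℚᵘ./ b                              ≈⟨ ℚᵘ.*≡* cross ⟩
  (+ q ℚᵘ./ r) ℚᵘ.* (+ c ℚᵘ./ d)          ≈⟨ ℚᵘ.*-cong (ℚ.toℚᵘ-fromℚᵘ (+ q ℚᵘ./ r)) (ℚ.toℚᵘ-fromℚᵘ (+ c ℚᵘ./ d)) ⟨
  toℚᵘ (+ q / r) ℚᵘ.* toℚᵘ (+ c / d)  ≈⟨ ℚ.toℚᵘ-homo-* (+ q / r) (+ c / d) ⟨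
  toℚᵘ ((+ q / r) * (+ c / d))          ∎)
  where
  open ℚᵘ.≃-Reasoning
  cross : + a *ℤ + (r *ℕ d) ≡ (+ q *ℤ + c) *ℤ + b
  cross = trans (sym (ℤ.pos-* a (r *ℕ d)))
    (trans (cong +_ eq) (trans (ℤ.pos-* (q *ℕ c) b) (cong (_*ℤ + b) (ℤ.pos-* q c))))

theorem3p3p10 : ∀ {m : ℕ} (M : Matroid m) → Loopless M →
    (R : Subset m) →
    (r q : ℕ) → .{{_ : NonZero r}} → .{{_ : NonZero q}} →
    (∀ x → ∣ closure M ⁅ x ⁆ ∩ R ∣ *ℕ r ≡ ∣ closure M ⁅ x ⁆ ∩ ∁ R ∣ *ℕ q) →
    (∀ k → 1 ≤ k → (k<n : k < rk M) →
    Ñ M R k (<⇒≤ k<n) * Ñ M R k (<⇒≤ k<n)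
    ≡ Ñ M R (pred k) (≤-trans pred[n]≤n (<⇒≤ k<n)) * Ñ M R (suc k) k<n)
    × (∀ k → 1 ≤ k → (k≤n : k ≤ rk M) →
    Ñ M R k k≤n ≡ (+ q / r) * Ñ M R (pred k) (≤-trans pred[n]≤n k≤n))
theorem3p3p10 M loopless R r q balanced = log-linear , λ { (suc k) _ k<n → ratio k k<n }
  where
  open ≡-Reasoning
  n = rk M

  cross : ∀ k → N M R (suc k) *ℕ (r *ℕ (n C k)) ≡ (q *ℕ N M R k) *ℕ (n C suc k)
  -- The extra factor `suc k` brings in the recurrences of `N M R` and of the binomials, whose
  -- common factor `n ∸ k` matches. Cancelling `suc k` is safe because it is never zero.
  cross k = *-cancelˡ-≡ _ _ (suc k) (begin
    suc k *ℕ (N M R (suc k) *ℕ (r *ℕ (n C k)))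
      ≡⟨ solve 4 (λ s a r c → s :* (a :* (r :* c)) := (r :* (s :* a)) :* c) refl (suc k) (N M R (suc k)) r (n C k) ⟩
    (r *ℕ (suc k *ℕ N M R (suc k))) *ℕ (n C k)
      ≡⟨ cong (_*ℕ (n C k)) (N-recurrence M R loopless r q balanced k) ⟩
    (q *ℕ ((n ∸ k) *ℕ N M R k)) *ℕ (n C k)
      ≡⟨ solve 4 (λ q d a c → (q :* (d :* a)) :* c := (q :* a) :* (d :* c)) refl q (n ∸ k) (N M R k) (n C k) ⟩
    (q *ℕ N M R k) *ℕ ((n ∸ k) *ℕ (n C k))
      ≡⟨ cong ((q *ℕ N M R k) *ℕ_) (suc-*-C n k) ⟨
    (q *ℕ N M R k) *ℕ (suc k *ℕ (n C suc k))
      ≡⟨ solve 3 (λ x s c → x :* (s :* c) := s :* (x :* c)) refl (q *ℕ N M R k) (suc k) (n C suc k) ⟩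
    suc k *ℕ ((q *ℕ N M R k) *ℕ (n C suc k))
      ∎)
    where open +-*-Solver

  ratio : ∀ k (k<n : suc k ≤ n) → Ñ M R (suc k) k<n ≡ (+ q / r) * Ñ M R k (≤-trans pred[n]≤n k<n)
  ratio k k<n = /-≡-*-/ (N M R (suc k)) (n C suc k) q r (N M R k) (n C k)
    {{b≢0 = nCk≢0 n (suc k) k<n}} {{d≢0 = nCk≢0 n k (≤-trans pred[n]≤n k<n)}} (cross k)

  log-linear : ∀ k → 1 ≤ k → (k<n : k < n) →
    Ñ M R k (<⇒≤ k<n) * Ñ M R k (<⇒≤ k<n)
    ≡ Ñ M R (pred k) (≤-trans pred[n]≤n (<⇒≤ k<n)) * Ñ M R (suc k) k<n
  log-linear (suc k) _ k<n = begin
    -- One factor `b` is lowered to `a` at the price of the ratio, which then raises the other `b`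
    -- by one index.
    b * b                 ≡⟨ cong (_* b) (ratio k (<⇒≤ k<n)) ⟩
    ((+ q / r) * a) * b   ≡⟨ cong (_* b) (ℚ.*-comm (+ q / r) a) ⟩
    (a * (+ q / r)) * b   ≡⟨ ℚ.*-assoc a (+ q / r) b ⟩
    -- The bound taken by `Ñ` is irrelevant, so the different proofs of it supplied here and in `b`
    -- agree.
    a * ((+ q / r) * b)   ≡⟨ cong (a *_) (ratio (suc k) k<n) ⟨
    a * Ñ M R (suc (suc k)) k<n ∎
    where
    a = Ñ M R k (≤-trans pred[n]≤n (<⇒≤ k<n))
    b = Ñ M R (suc k) (<⇒≤ k<n)
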